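{- For every tree $T$ we have $\overleftrightarrow{\chi}(T) \leq 3$, and this bound is sharp, i.e. there exists a tree $T$ with $\overleftrightarrow{\chi}(T) = 3$.
   Context: All graphs are finite and simple. An orientation $D$ of a graph $G$ is a digraph obtained by replacing each edge of $G$ by exactly one of the two possible arcs with the same endvertices. For a vertex $v$, $d_D^-(v)$ (in-degree) is the number of arcs with head $v$, $d_D^+(v)$ (out-degree) is the number of arcs with tail $v$, and the in-out-degree is $d_D^{\pm}(v) = d_D^-(v) - d_D^+(v)$. An orientation $D$ of $G$ is in-out-proper if $d_D^{\pm}(u) \neq d_D^{\pm}(v)$ for any two adjacent vertices $u,v$. The in-out-proper orientation number of $G$ is $\overleftrightarrow{\chi}(G) = \min_{D\in\Gamma}\max_{v\in V(G)} |d_D^{\pm}(v)|$, where $\Gamma$ is the set of in-out-proper orientations of $G$ (it is known that $\Gamma$ is nonempty for every graph $G$). -}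

module Defs where

open import Data.Fin.Base using (Fin)
open import Data.Integer.Base using (ℤ; +_; _-_; ∣_∣)
open import Data.List.Base using (List; []; _∷_; _++_; length; filter; map; allFin)
open import Data.List.Extrema.Nat using (max)
open import Data.List.Relation.Unary.Linked using (Linked)
open import Data.List.Relation.Unary.Unique.Propositional using (Unique)
open import Data.Nat.Base using (ℕ; _≤_; NonZero)
open import Data.Nat.Properties using (≤-antisym)
open import Data.Product.Base using (Σ-syntax; _×_; _,_)
open import Data.Sum.Base using (_⊎_)
open import Level using (0ℓ)
open import Relation.Binary.Construct.Closure.ReflexiveTransitive using (Star)
open import Relation.Binary.Core using (Rel)
open import Relation.Binary.Definitions using (Decidable; Symmetric; Irreflexive; Asymmetric)
open import Relation.Binary.PropositionalEquality using (_≡_; _≢_; refl)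
open import Relation.Nullary.Negation using (¬_)

record Graph : Set₁ where
  infix 4 _~_ _~?_
  field
    order  : ℕ

  Vertex : Set
  Vertex = Fin order

  field
    _~_    : Rel Vertex 0ℓ
    _~?_   : Decidable _~_
    sym    : Symmetric _~_
    irrefl : Irreflexive _≡_ _~_

module _ (G : Graph) where
  open Graph G

  Connected : Set
  Connected = ∀ u v → Star _~_ u v

  -- The closed walk u v w … u. Only the final return to u repeats a vertex,
  -- and naming v and w forces length at least 3.
  IsCycle : Vertex → Vertex → Vertex → List Vertex → Set
  IsCycle u v w ws =
    Unique (u ∷ v ∷ w ∷ ws) × Linked _~_ (u ∷ v ∷ w ∷ ws ++ u ∷ [])

  Acyclic : Set
  Acyclic = ∀ u v w ws → ¬ IsCycle u v w ws

  record IsTree : Set where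
    field
      nonEmpty  : NonZero order
      connected : Connected
      acyclic   : Acyclic

  record Orientation : Set₁ where
    infix 4 _⟶_ _⟶?_
    field
      _⟶_    : Rel Vertex 0ℓ
      _⟶?_   : Decidable _⟶_
      arc⇒adj : ∀ {u v} → u ⟶ v → u ~ v
      adj⇒arc : ∀ {u v} → u ~ v → u ⟶ v ⊎ v ⟶ u
      asym    : Asymmetric _⟶_

    inDegree : Vertex → ℕ
    inDegree v = length (filter (λ u → u ⟶? v) (allFin order))

    outDegree : Vertex → ℕ
    outDegree v = length (filter (λ u → v ⟶? u) (allFin order))

    inOutDegree : Vertex → ℤ
    inOutDegree v = + inDegree v - + outDegree v

    InOutProper : Set
    InOutProper = ∀ {u v} → u ~ v → inOutDegree u ≢ inOutDegree v

    -- The default value 0 is harmless, as absolute values are nonnegative.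
    maxInOutDegree : ℕ
    maxInOutDegree = max 0 (map (λ v → ∣ inOutDegree v ∣) (allFin order))

  open Orientation using (InOutProper; maxInOutDegree)

  -- "k is the in-out-proper orientation number of G", i.e. the minimum is
  -- attained and equals k. This is a relation rather than a function because
  -- the minimum as a function would presuppose that every graph has an
  -- in-out-proper orientation.
  record IsInOutProperOrientationNumber (k : ℕ) : Set₁ where
    field
      attained : Σ[ D ∈ Orientation ] InOutProper D × maxInOutDegree D ≡ k
      minimal  : ∀ D → InOutProper D → k ≤ maxInOutDegree D

  inOutProperOrientationNumber-unique : ∀ {k l} →
    IsInOutProperOrientationNumber k → IsInOutProperOrientationNumber l → k ≡ l
  inOutProperOrientationNumber-unique
    record { attained = D , pD , refl ; minimal = minD }
    record { attained = E , pE , refl ; minimal = minE } =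
    ≤-antisym (minD E pE) (minE D pD)

{-# OPTIONS --safe #-}
module Submission where

-- The vertices of a forest can be listed so that each has at most one earlier
-- neighbour. Process them in this order; at v orient the edges to all later
-- neighbours, which lets the in-out-degree of v take any value of the right
-- parity in a range given by the number c of these edges. If v has an earlier
-- neighbour p, with say p → v (the case v → p is symmetric), two values are
-- available whenever c > 0: 0 and 2 if c is odd, -1 and 3 if c = 2, and ±3 if
-- c ≥ 4 is even; one of them differs from the value of p. If c = 0 then v is a
-- leaf and must take the value 1; this is harmless because a vertex of value 1
-- only ever receives incoming edges among those it orients, so that p → v rules
-- out the value 1 for p. Without an earlier neighbour, 0, 1 or 3 is taken.
--
-- For the star K₁,₃ the centre has an odd value. If it were ±1, then both
-- directions would occur at the centre, so one leaf would have value 1 and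
-- another -1. Hence the value is ±3.

open import Defs
open import Data.Bool.Base using (Bool; true; false; T; not)
open import Data.Bool.Properties using (T?)
open import Data.Empty using (⊥)
open import Data.Fin.Base using (Fin; zero; suc; combine; remQuot)
open import Data.Fin.Properties using (_≟_; suc-injective; any?; all?; remQuot-combine)
open import Data.Fin.Subset using (Subset; _∈_; _∉_; _⊂_; _-_; ⊤; Nonempty; inside; outside)
open import Data.Fin.Subset.Induction using (⊂-wellFounded)
open import Data.Fin.Subset.Properties using (_∈?_; ∈⊤; p─q⊆p; x∈p∧x≢y⇒x∈p-y; x∈p⇒p-x⊂p; nonempty?; anySubset?)
open import Data.Integer.Base using (ℤ; +_; -[1+_]; -_; _⊖_; ∣_∣; 0ℤ; 1ℤ; -1ℤ) renaming (_-_ to _ℤ-_)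
import Data.Integer.Properties as ℤ
open import Data.List.Base using ([]; _∷_; _++_; length; filter; map; tabulate; allFin)
open import Data.List.Extrema.Nat using (max; max≤v⁺; xs≤max)
open import Data.List.Membership.Propositional using () renaming (_∈_ to _∈ˡ_)
open import Data.List.Membership.Propositional.Properties using (∈-allFin; ∈-map⁺)
open import Data.List.Properties using (filter-≐; filter-none; filter-some; map-cong; map-tabulate)
open import Data.List.Relation.Binary.Subset.Propositional using (_⊆_)
open import Data.List.Relation.Unary.All as All using (_∷_)
import Data.List.Relation.Unary.All.Properties as All
open import Data.List.Relation.Unary.AllPairs using ([]; _∷_)
open import Data.List.Relation.Unary.Any as Any using (here; there)
open import Data.List.Relation.Unary.Linked using (Linked; [-]; _∷_)
open import Data.List.Relation.Unary.Unique.Propositional using (Unique)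
open import Data.Nat.Base using (ℕ; zero; suc; _+_; _*_; _≤_; _<_; z≤n; s≤s)
open import Data.Nat.Induction using (Acc; acc; <-wellFounded)
import Data.Nat.Properties as ℕ
open import Data.Nat.Tactic.RingSolver using (solve-∀)
open import Data.Product.Base using (Σ-syntax; ∃-syntax; _×_; _,_; proj₁; proj₂; uncurry)
open import Data.Sum.Base as Sum using (_⊎_; inj₁; inj₂; [_,_]; [_,_]′)
open import Data.Unit.Base using (tt) renaming (⊤ to Unit)
import Data.Vec.Base as Vec
open import Data.Vec.Base using (_∷_; here; there)
open import Data.Vec.Functional using () renaming (_∷_ to _▹_)
open import Data.Vec.Properties using (lookup∘tabulate; []=⇒lookup; lookup⇒[]=)
open import Function.Base using (_∘_; id; const)
open import Level using (0ℓ)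
open import Relation.Binary.Construct.Closure.ReflexiveTransitive using (ε; _◅_)
open import Relation.Binary.Core using (Rel)
open import Relation.Binary.Definitions using (Asymmetric) renaming (Decidable to Decidable₂)
open import Relation.Binary.PropositionalEquality using (_≡_; _≢_; refl; sym; trans; cong; cong₂; subst; subst₂; ≢-sym; module ≡-Reasoning)
open import Relation.Nullary.Decidable using (Dec; does; yes; no; ⌊_⌋; map′; ¬?; _×-dec_; _⊎-dec_; _→-dec_; decidable-stable; dec-true; dec-false; toWitness; fromWitness)
open import Relation.Nullary.Negation using (¬_; contradiction)
open import Relation.Unary using (Pred; Decidable; _≐_; _∩_; ∁; Empty)
open import Relation.Unary.Properties using (_∪?_; _∩?_; ∁?)

-- Counting decidable subsets of `Fin n`.

private variable
  n : ℕ
  P Q : Pred (Fin n) 0ℓ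

count : Decidable P → ℕ
count P? = length (filter P? (allFin _))

count-cong : (P? : Decidable P) (Q? : Decidable Q) → P ≐ Q → count P? ≡ count Q?
count-cong P? Q? P≐Q = cong length (filter-≐ P? Q? P≐Q (allFin _))

count-empty : (P? : Decidable P) → Empty P → count P? ≡ 0
count-empty P? ¬P = cong length (filter-none P? (All.universal ¬P (allFin _)))

count≡0⇒empty : (P? : Decidable P) → count P? ≡ 0 → Empty P
count≡0⇒empty P? eq x Px with () ← subst (0 <_) eq
  (filter-some P? (Any.map (λ { refl → Px }) (∈-allFin x)))

count-∪ : (P? : Decidable P) (Q? : Decidable Q) → Empty (P ∩ Q) →
          count (P? ∪? Q?) ≡ count P? + count Q?
count-∪ {P = P} {Q = Q} P? Q? disjoint = go (allFin _)
  where
  go : ∀ xs → length (filter (P? ∪? Q?) xs) ≡ length (filter P? xs) + length (filter Q? xs)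
  go [] = refl
  go (x ∷ xs) with P? x | Q? x
  ... | yes p | yes q = contradiction (p , q) (disjoint x)
  ... | yes _ | no  _ = cong suc (go xs)
  ... | no  _ | yes _ = trans (cong suc (go xs)) (sym (ℕ.+-suc _ _))
  ... | no  _ | no  _ = go xs

-- `allFin (suc n)` unfolds to `zero ∷ tabulate suc`, so this handles what remains of `count P?`
-- once the test at `zero` is resolved.
count-tail : {P : Pred (Fin (suc n)) 0ℓ} (P? : Decidable P) →
             length (filter P? (tabulate suc)) ≡ count (P? ∘ suc)
count-tail {n} P? = trans (cong (length ∘ filter P?) (sym (map-tabulate id suc))) (go (allFin n))
  where
  go : ∀ xs → length (filter P? (map suc xs)) ≡ length (filter (P? ∘ suc) xs)
  go [] = refl
  go (x ∷ xs) with does (P? (suc x))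
  ... | true  = cong suc (go xs)
  ... | false = go xs

count-singleton : (p : Fin n) → count (_≟ p) ≡ 1
count-singleton {suc n} zero =
  cong suc (trans (count-tail {n} (_≟ zero)) (count-empty {n} (λ x → suc x ≟ zero) λ _ ()))
count-singleton (suc p) = trans (count-tail (_≟ suc p))
  (trans (count-cong (λ x → suc x ≟ suc p) (_≟ p) (suc-injective , cong suc)) (count-singleton p))

-- Greedy choice: elements of `P` are marked `true` until `i` of them are used up, and `false` from
-- then on. It realises prescribed numbers of incoming and outgoing arcs.
partition : (P? : Decidable P) → ∀ i o → i + o ≡ count P? →
            ∃[ q ] count (P? ∩? (T? ∘ q)) ≡ i × count (P? ∩? ∁? (T? ∘ q)) ≡ o
partition {zero} P? zero zero eq = const false , refl , refl
partition {suc n} P? i o eq with P? zero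
... | no _ =
  let q , ins , outs = partition (P? ∘ suc) i o (trans eq (count-tail P?))
  in  false ▹ q ,
      trans (count-tail (P? ∩? (T? ∘ (false ▹ q)))) ins ,
      trans (count-tail (P? ∩? ∁? (T? ∘ (false ▹ q)))) outs
partition {suc n} P? (suc i) o eq | yes _ =
  let q , ins , outs = partition (P? ∘ suc) i o (trans (ℕ.suc-injective eq) (count-tail P?))
  in  true ▹ q ,
      cong suc (trans (count-tail (P? ∩? (T? ∘ (true ▹ q)))) ins) ,
      trans (count-tail (P? ∩? ∁? (T? ∘ (true ▹ q)))) outs
partition {suc n} P? zero (suc o) eq | yes _ =
  let q , ins , outs = partition (P? ∘ suc) zero o (trans (ℕ.suc-injective eq) (count-tail P?))
  in  false ▹ q ,
      trans (count-tail (P? ∩? (T? ∘ (false ▹ q)))) ins ,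
      cong suc (trans (count-tail (P? ∩? ∁? (T? ∘ (false ▹ q)))) outs)

-- Arithmetic of the values available at one vertex.

-- Here `a` and `b` count the arcs already entering and leaving a vertex, `c` its edges still to be
-- oriented, and `z` is the intended value. The last two fields keep later leaves safe: they provide
-- `1⇒in` and `-1⇒out` for the enlarged set.
record Balance (a b c : ℕ) (z : ℤ) : Set where
  field
    ins outs : ℕ
    total    : ins + outs ≡ c
    value    : + (a + ins) ℤ- + (b + outs) ≡ z
    bounded  : ∣ z ∣ ≤ 3
    1⇒source : z ≡ 1ℤ → outs ≡ 0
    -1⇒sink  : z ≡ -1ℤ → ins ≡ 0

-- Cancelling the summand common to both counts leaves a difference of numerals that computes, which
-- settles the `value` fields below.
+-cancelʳ-⊖ : ∀ k m n → + (m + k) ℤ- + (n + k) ≡ m ⊖ n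
+-cancelʳ-⊖ k m n = begin
  + (m + k) ℤ- + (n + k)  ≡⟨ ℤ.[+m]-[+n]≡m⊖n (m + k) (n + k) ⟩
  (m + k) ⊖ (n + k)      ≡⟨ cong₂ _⊖_ (ℕ.+-comm m k) (ℕ.+-comm n k) ⟩
  (k + m) ⊖ (k + n)      ≡⟨ ℤ.+-cancelˡ-⊖ k m n ⟩
  m ⊖ n                  ∎
  where open ≡-Reasoning

halve : ∀ c → ∃[ k ] (c ≡ k + k ⊎ c ≡ suc (k + k))
halve zero = 0 , inj₁ refl
halve (suc c) with halve c
... | k , inj₁ refl = k , inj₂ refl
... | k , inj₂ refl = suc k , inj₁ (cong suc (sym (ℕ.+-suc k k)))

balanceRoot : ∀ c → ∃[ z ] Balance 0 0 c z
balanceRoot c with halve c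
... | k , inj₁ refl = 0ℤ , record
  { ins = k ; outs = k ; total = refl ; value = +-cancelʳ-⊖ k 0 0
  ; bounded = z≤n ; 1⇒source = λ () ; -1⇒sink = λ () }
... | zero , inj₂ refl = 1ℤ , record
  { ins = 1 ; outs = 0 ; total = refl ; value = refl
  ; bounded = s≤s z≤n ; 1⇒source = λ _ → refl ; -1⇒sink = λ () }
-- From three edges on, value 1 would need an outgoing one, against `1⇒source`; 3 is the next odd
-- value.
... | suc j , inj₂ refl = + 3 , record
  { ins = 3 + j ; outs = j ; total = total j ; value = +-cancelʳ-⊖ j 3 0
  ; bounded = ℕ.≤-refl ; 1⇒source = λ () ; -1⇒sink = λ () }
  where
  total : ∀ j → 3 + j + j ≡ suc (suc j + suc j)
  total = solve-∀

avoid : ∀ (P : ℤ → Set) y z x → y ≢ z → P y → P z → ∃[ w ] w ≢ x × P w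
avoid P y z x y≢z py pz with y ℤ.≟ x
... | no  y≢x  = y , y≢x , py
... | yes refl = z , ≢-sym y≢z , pz

balanceIn : ∀ c x → (c ≡ 0 → x ≢ 1ℤ) → ∃[ z ] z ≢ x × Balance 1 0 c z
balanceIn c x guard with halve c
... | zero , inj₁ refl = 1ℤ , ≢-sym (guard refl) , record
  { ins = 0 ; outs = 0 ; total = refl ; value = refl
  ; bounded = s≤s z≤n ; 1⇒source = λ _ → refl ; -1⇒sink = λ () }
-- The reachable values are -1, 1 and 3, and 1 would need one new arc in each direction.
... | suc zero , inj₁ refl = avoid (Balance 1 0 2) -1ℤ (+ 3) x (λ ())
  (record { ins = 0 ; outs = 2 ; total = refl ; value = refl
          ; bounded = s≤s z≤n ; 1⇒source = λ () ; -1⇒sink = λ _ → refl })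
  (record { ins = 2 ; outs = 0 ; total = refl ; value = refl
          ; bounded = ℕ.≤-refl ; 1⇒source = λ () ; -1⇒sink = λ () })
-- Now -1 would need an incoming new arc, against `-1⇒sink`, but -3 has come within reach.
... | suc (suc j) , inj₁ refl = avoid (Balance 1 0 _) (+ 3) -[1+ 2 ] x (λ ())
  (record { ins = 3 + j ; outs = 1 + j ; total = total₁ j ; value = +-cancelʳ-⊖ j 4 1
          ; bounded = ℕ.≤-refl ; 1⇒source = λ () ; -1⇒sink = λ () })
  (record { ins = j ; outs = 4 + j ; total = total₂ j ; value = +-cancelʳ-⊖ j 1 4
          ; bounded = ℕ.≤-refl ; 1⇒source = λ () ; -1⇒sink = λ () })
  where
  total₁ : ∀ j → 3 + j + (1 + j) ≡ 2 + j + (2 + j)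
  total₁ = solve-∀
  total₂ : ∀ j → j + (4 + j) ≡ 2 + j + (2 + j)
  total₂ = solve-∀
... | k , inj₂ refl = avoid (Balance 1 0 _) 0ℤ (+ 2) x (λ ())
  (record { ins = k ; outs = suc k ; total = ℕ.+-suc k k ; value = +-cancelʳ-⊖ k 1 1
          ; bounded = z≤n ; 1⇒source = λ () ; -1⇒sink = λ () })
  (record { ins = suc k ; outs = k ; total = refl ; value = +-cancelʳ-⊖ k 2 0
          ; bounded = s≤s (s≤s z≤n) ; 1⇒source = λ () ; -1⇒sink = λ () })

neg-flip : ∀ {i j} → - i ≡ j → i ≡ - j
neg-flip {i} refl = sym (ℤ.neg-involutive i)

-- Reversing all arcs negates the value and exchanges the conditions at 1 and -1. Thus `balanceOut`
-- follows from `balanceIn` applied to `- x`.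
neg-Balance : ∀ {a b c z} → Balance a b c z → Balance b a c (- z)
neg-Balance {a} {b} {z = z} β = record
  { ins      = outs
  ; outs     = ins
  ; total    = trans (ℕ.+-comm outs ins) total
  ; value    = begin
      + (b + outs) ℤ- + (a + ins)      ≡⟨ ℤ.[+m]-[+n]≡m⊖n (b + outs) (a + ins) ⟩
      (b + outs) ⊖ (a + ins)          ≡⟨ ℤ.⊖-swap (b + outs) (a + ins) ⟩
      - ((a + ins) ⊖ (b + outs))      ≡⟨ cong -_ (ℤ.[+m]-[+n]≡m⊖n (a + ins) (b + outs)) ⟨
      - (+ (a + ins) ℤ- + (b + outs))  ≡⟨ cong -_ value ⟩
      - z                             ∎
  ; bounded  = subst (_≤ 3) (sym (ℤ.∣-i∣≡∣i∣ z)) bounded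
  ; 1⇒source = λ eq → -1⇒sink (neg-flip eq)
  ; -1⇒sink  = λ eq → 1⇒source (neg-flip eq)
  }
  where
  open Balance β
  open ≡-Reasoning

balanceOut : ∀ c x → (c ≡ 0 → x ≢ -1ℤ) → ∃[ z ] z ≢ x × Balance 0 1 c z
balanceOut c x guard =
  let z , z≢-x , β = balanceIn c (- x) (λ c≡0 eq → guard c≡0 (neg-flip eq))
  in  - z , (λ eq → z≢-x (neg-flip eq)) , neg-Balance β

-- Vertices with at most one neighbour in a given set.

x∉p-x : ∀ {n} (p : Subset n) x → x ∉ p - x
x∉p-x (outside ∷ p) zero ()
x∉p-x (inside  ∷ p) zero ()
x∉p-x (_ ∷ p) (suc x) (there x∈) = x∉p-x p x x∈

module _ (G : Graph) where
  open Graph G renaming (sym to ~-sym)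

  -- The path is cut off after `x`, from where the edge to `h` closes it. The inclusion in `ys` lets
  -- the shortened path inherit distinctness from the vertices that precede it.
  closeWalk : ∀ {h x y ys} → Unique ys → Linked _~_ (y ∷ ys) → x ∈ˡ ys → x ~ h →
              ∃[ w ] ∃[ ws ] w ∷ ws ⊆ ys × Unique (w ∷ ws) × Linked _~_ (y ∷ w ∷ ws ++ h ∷ [])
  closeWalk {x = x} _ (y~x ∷ _) (here refl) x~h =
    x , [] , (λ { (here refl) → here refl }) , (All.[] ∷ []) , (y~x ∷ x~h ∷ [-])
  closeWalk {ys = y′ ∷ _} (y′∉ ∷ uniq) (y~y′ ∷ link) (there x∈) x~h =
    let w , ws , ⊆ys , uniq′ , link′ = closeWalk uniq link x∈ x~h
    in  y′ , w ∷ ws , (λ { (here refl) → here refl ; (there i) → there (⊆ys i) }) ,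
        (All.anti-mono ⊆ys y′∉ ∷ uniq′) , (y~y′ ∷ link′)

  AtMostOneNeighbour : Subset order → Vertex → Set
  AtMostOneNeighbour S v = ∀ {p q} → p ∈ S → q ∈ S → p ~ v → q ~ v → p ≡ q

  -- A path in S is prolonged at its head as long as the head has a second
  -- neighbour in S; S′ holds the vertices of S not yet on the path.
  prolong : Acyclic G → ∀ {S S′} → Acc _⊂_ S′ → ∀ {u v ws} →
            Unique (u ∷ v ∷ ws) → Linked _~_ (u ∷ v ∷ ws) → u ∈ S →
            (∀ {x} → x ∈ S′ → ¬ x ∈ˡ u ∷ v ∷ ws) →
            (∀ {x} → x ∈ S → x ∈ S′ ⊎ x ∈ˡ u ∷ v ∷ ws) →
            ∃[ x ] x ∈ S × AtMostOneNeighbour S x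
  prolong acyclic {S} {S′} (acc rec) {u} {v} {ws} (u∉ ∷ v∉ ∷ uniq) (u~v ∷ link) u∈S off cover
    with any? (λ x → x ∈? S ×-dec x ~? u ×-dec ¬? (x ≟ v))
  ... | no none = u , u∈S , λ p∈S q∈S p~u q~u → trans (isV p∈S p~u) (sym (isV q∈S q~u))
    where
    isV : ∀ {x} → x ∈ S → x ~ u → x ≡ v
    isV {x} x∈S x~u = decidable-stable (x ≟ v) λ x≢v → none (x , x∈S , x~u , x≢v)
  ... | yes (x , x∈S , x~u , x≢v) with cover x∈S
  ... | inj₂ (here x≡u) = contradiction x~u (irrefl x≡u)
  ... | inj₂ (there (here x≡v)) = contradiction x≡v x≢v
  -- A neighbour of the head further down the path would close a cycle through `u` and `v`.
  ... | inj₂ (there (there x∈ws)) =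
    let w , ws′ , ⊆ws , uniq′ , link′ = closeWalk uniq link x∈ws x~u
        sub : v ∷ w ∷ ws′ ⊆ v ∷ ws
        sub = λ { (here e) → here e ; (there i) → there (⊆ws i) }
    in  contradiction ((All.anti-mono sub u∉ ∷ All.anti-mono ⊆ws v∉ ∷ uniq′) , (u~v ∷ link′))
          (acyclic u v w ws′)
  ... | inj₁ x∈S′ = prolong acyclic (rec (x∈p⇒p-x⊂p x∈S′))
    (All.tabulate (λ i eq → off x∈S′ (subst (_∈ˡ _) (sym eq) i)) ∷ u∉ ∷ v∉ ∷ uniq)
    (x~u ∷ u~v ∷ link) x∈S
    (λ { y∈ (here refl) → x∉p-x S′ x y∈
       ; y∈ (there i) → off (p─q⊆p S′ _ y∈) i })
    λ {y} y∈S → cover′ y y∈S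
    where
    cover′ : ∀ y → y ∈ S → y ∈ S′ - x ⊎ y ∈ˡ x ∷ u ∷ v ∷ ws
    cover′ y y∈S with y ≟ x | cover y∈S
    ... | yes y≡x | _ = inj₂ (here y≡x)
    ... | no  y≢x | inj₁ y∈S′ = inj₁ (x∈p∧x≢y⇒x∈p-y y∈S′ y≢x)
    ... | no  _   | inj₂ i = inj₂ (there i)

  -- Either `v` is isolated within `S`, or an edge of `S` at `v` is the initial path for `prolong`.
  leaf : Acyclic G → ∀ {S} → Nonempty S → ∃[ x ] x ∈ S × AtMostOneNeighbour S x
  leaf acyclic {S} (v , v∈S) with any? (λ x → x ∈? S ×-dec x ~? v)
  ... | no none = v , v∈S , λ p∈S _ p~v _ → contradiction (_ , p∈S , p~v) none
  ... | yes (u , u∈S , u~v) = prolong acyclic (⊂-wellFounded (S - v - u))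
    ((All.tabulate (λ { (here refl) u≡v → irrefl u≡v u~v ; (there ()) }) ∷ All.[] ∷ [])) (u~v ∷ [-]) u∈S
    (λ { x∈ (here refl) → x∉p-x (S - v) u x∈
       ; x∈ (there (here refl)) → x∉p-x S v (p─q⊆p (S - v) _ x∈) })
    λ {x} → cover x
    where
    cover : ∀ x → x ∈ S → x ∈ S - v - u ⊎ x ∈ˡ u ∷ v ∷ []
    cover x x∈S with x ≟ u | x ≟ v
    ... | yes x≡u | _       = inj₂ (here x≡u)
    ... | no  _   | yes x≡v = inj₂ (there (here x≡v))
    ... | no  x≢u | no  x≢v = inj₁ (x∈p∧x≢y⇒x∈p-y (x∈p∧x≢y⇒x∈p-y x∈S x≢v) x≢u)

  -- Partial orientations and their extension by one vertex.

  -- Only the edges meeting S are oriented. The last two conditions ensure that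
  -- a leaf outside S does not get the value of its neighbour in S.
  record PartialOrientation (S : Subset order) : Set₁ where
    infix 4 _⟶_ _⟶?_
    field
      _⟶_      : Rel Vertex 0ℓ
      _⟶?_     : Decidable₂ _⟶_
      arc⇒adj  : ∀ {u v} → u ⟶ v → u ~ v
      arc⇒meets : ∀ {u v} → u ⟶ v → u ∈ S ⊎ v ∈ S
      adj⇒arc  : ∀ {u v} → u ∈ S → u ~ v → u ⟶ v ⊎ v ⟶ u
      asym     : Asymmetric _⟶_

    ins : Vertex → ℕ
    ins v = count (_⟶? v)

    outs : Vertex → ℕ
    outs v = count (v ⟶?_)

    value : Vertex → ℤ
    value v = + ins v ℤ- + outs v

    field
      bounded : ∀ {u} → u ∈ S → ∣ value u ∣ ≤ 3
      proper  : ∀ {u v} → u ∈ S → v ∈ S → u ~ v → value u ≢ value v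
      1⇒in    : ∀ {u v} → u ∈ S → v ∉ S → u ~ v → value u ≡ 1ℤ → v ⟶ u
      -1⇒out  : ∀ {u v} → u ∈ S → v ∉ S → u ~ v → value u ≡ -1ℤ → u ⟶ v

  module _ {S v} (v∈S : v ∈ S) (D : PartialOrientation (S - v)) where
    private module D = PartialOrientation D
    open D using (_⟶_; _⟶?_)

    -- The edges from `v` into `S - v` are already oriented by `D`, so exactly those to the free
    -- vertices are left.
    Free : Pred Vertex 0ℓ
    Free u = v ~ u × u ∉ S

    free? : Decidable Free
    free? u = v ~? u ×-dec ¬? (u ∈? S)

    ∈-weaken : ∀ {u} → u ∈ S - v → u ∈ S
    ∈-weaken = p─q⊆p S _

    ∈-split : ∀ {u} → u ∈ S → u ≡ v ⊎ u ∈ S - v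
    ∈-split {u} u∈S with u ≟ v
    ... | yes u≡v = inj₁ u≡v
    ... | no  u≢v = inj₂ (x∈p∧x≢y⇒x∈p-y u∈S u≢v)

    v∉ : v ∉ S - v
    v∉ = x∉p-x S v

    -- All new arcs join `v` to vertices outside `S`, so values in `S - v` do not change. Hence only
    -- `z` has to be compared with the values of the neighbours of `v`.
    extend : ∃[ z ] (∀ {u} → u ∈ S - v → u ~ v → z ≢ D.value u) ×
                    Balance (D.ins v) (D.outs v) (count free?) z →
             PartialOrientation S
    extend (z , z≢ , β) = record
      { _⟶_ = _⟶′_ ; _⟶?_ = _⟶′?_
      ; arc⇒adj = arc⇒adj ; arc⇒meets = arc⇒meets ; adj⇒arc = adj⇒arc ; asym = asym
      ; bounded = bounded ; proper = proper ; 1⇒in = 1⇒in ; -1⇒out = -1⇒out }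
      where
      module β = Balance β

      chosen = partition free? β.ins β.outs β.total
      q = proj₁ chosen

      Into From : Pred Vertex 0ℓ
      Into = Free ∩ (T ∘ q)
      From = Free ∩ ∁ (T ∘ q)

      into? : Decidable Into
      into? = free? ∩? (T? ∘ q)
      from? : Decidable From
      from? = free? ∩? ∁? (T? ∘ q)

      data _⟶′_ : Rel Vertex 0ℓ where
        old  : ∀ {x y} → x ⟶ y → x ⟶′ y
        into : ∀ {x} → Into x → x ⟶′ v
        from : ∀ {x} → From x → v ⟶′ x

      _⟶′?_ : Decidable₂ _⟶′_
      x ⟶′? y = map′
        (λ { (inj₁ a) → old a ; (inj₂ (inj₁ (refl , i))) → into i ; (inj₂ (inj₂ (refl , i))) → from i })
        (λ { (old a) → inj₁ a ; (into i) → inj₂ (inj₁ (refl , i)) ; (from i) → inj₂ (inj₂ (refl , i)) })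
        (x ⟶? y ⊎-dec y ≟ v ×-dec into? x ⊎-dec x ≟ v ×-dec from? y)

      arc⇒adj : ∀ {x y} → x ⟶′ y → x ~ y
      arc⇒adj (old a) = D.arc⇒adj a
      arc⇒adj (into ((v~x , _) , _)) = ~-sym v~x
      arc⇒adj (from ((v~x , _) , _)) = v~x

      arc⇒meets : ∀ {x y} → x ⟶′ y → x ∈ S ⊎ y ∈ S
      arc⇒meets (old a) = Sum.map ∈-weaken ∈-weaken (D.arc⇒meets a)
      arc⇒meets (into _) = inj₂ v∈S
      arc⇒meets (from _) = inj₁ v∈S

      adj⇒arc : ∀ {x y} → x ∈ S → x ~ y → x ⟶′ y ⊎ y ⟶′ x
      adj⇒arc {x} {y} x∈S x~y with ∈-split x∈S
      ... | inj₂ x∈ = Sum.map old old (D.adj⇒arc x∈ x~y)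
      ... | inj₁ refl with y ∈? S
      ... | no y∉S with T? (q y)
      ...   | yes t = inj₂ (into ((x~y , y∉S) , t))
      ...   | no ¬t = inj₁ (from ((x~y , y∉S) , ¬t))
      adj⇒arc {x} {y} x∈S x~y | inj₁ refl | yes y∈S with ∈-split y∈S
      ... | inj₁ y≡v = contradiction x~y (irrefl (sym y≡v))
      ... | inj₂ y∈ = Sum.swap (Sum.map old old (D.adj⇒arc y∈ (~-sym x~y)))

      -- An old arc meets `S - v`, whereas neither `v` nor a free vertex lies there.
      old∧free : ∀ {x} → (v ⟶ x ⊎ x ⟶ v) → ¬ Free x
      old∧free a (v~x , x∉S) with [ D.arc⇒meets , Sum.swap ∘ D.arc⇒meets ]′ a
      ... | inj₁ v∈ = v∉ v∈
      ... | inj₂ x∈ = x∉S (∈-weaken x∈)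

      free-irrefl : ¬ Free v
      free-irrefl (v~v , _) = irrefl refl v~v

      asym : Asymmetric _⟶′_
      asym (old a) (old b) = D.asym a b
      asym (old a) (into (i , _)) = old∧free (inj₁ a) i
      asym (old a) (from (i , _)) = old∧free (inj₂ a) i
      asym (into (i , _)) (old b) = old∧free (inj₁ b) i
      asym (into (i , _)) (into _) = free-irrefl i
      asym (into (_ , t)) (from (_ , ¬t)) = ¬t t
      asym (from (i , _)) (old b) = old∧free (inj₂ b) i
      asym (from (_ , ¬t)) (into (_ , t)) = ¬t t
      asym (from (i , _)) (from _) = free-irrefl i

      ins′ outs′ : Vertex → ℕ
      ins′ u  = count (_⟶′? u)
      outs′ u = count (u ⟶′?_)

      value′ : Vertex → ℤ
      value′ u = + ins′ u ℤ- + outs′ u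

      value′≡z : value′ v ≡ z
      value′≡z = trans (cong₂ (λ a b → + a ℤ- + b) ins≡ outs≡) β.value
        where
        open ≡-Reasoning
        ins≡ : ins′ v ≡ D.ins v + β.ins
        ins≡ = begin
          ins′ v                          ≡⟨ count-cong (_⟶′? v) ((_⟶? v) ∪? into?)
            ( (λ { (old a) → inj₁ a ; (into i) → inj₂ i ; (from (i , _)) → contradiction i free-irrefl })
            , [ old , into ]) ⟩
          count ((_⟶? v) ∪? into?)        ≡⟨ count-∪ (_⟶? v) into? (λ _ (a , i , _) → old∧free (inj₂ a) i) ⟩
          D.ins v + count into?           ≡⟨ cong (λ k → D.ins v + k) (proj₁ (proj₂ chosen)) ⟩
          D.ins v + β.ins                 ∎
        outs≡ : outs′ v ≡ D.outs v + β.outs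
        outs≡ = begin
          outs′ v                         ≡⟨ count-cong (v ⟶′?_) ((v ⟶?_) ∪? from?)
            ( (λ { (old a) → inj₁ a ; (into (i , _)) → contradiction i free-irrefl ; (from i) → inj₂ i })
            , [ old , from ]) ⟩
          count ((v ⟶?_) ∪? from?)        ≡⟨ count-∪ (v ⟶?_) from? (λ _ (a , i , _) → old∧free (inj₁ a) i) ⟩
          D.outs v + count from?          ≡⟨ cong (λ k → D.outs v + k) (proj₂ (proj₂ chosen)) ⟩
          D.outs v + β.outs               ∎

      value′-old : ∀ {u} → u ∈ S - v → value′ u ≡ D.value u
      value′-old {u} u∈ = cong₂ (λ a b → + a ℤ- + b)
        (count-cong (_⟶′? u) (_⟶? u)
          ( (λ { (old a) → a ; (into _) → contradiction u∈ v∉ ; (from ((_ , u∉S) , _)) → contradiction (∈-weaken u∈) u∉S })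
          , old))
        (count-cong (u ⟶′?_) (u ⟶?_)
          ( (λ { (old a) → a ; (into ((_ , u∉S) , _)) → contradiction (∈-weaken u∈) u∉S ; (from _) → contradiction u∈ v∉ })
          , old))

      bounded : ∀ {u} → u ∈ S → ∣ value′ u ∣ ≤ 3
      bounded u∈S with ∈-split u∈S
      ... | inj₁ refl = subst (λ i → ∣ i ∣ ≤ 3) (sym value′≡z) β.bounded
      ... | inj₂ u∈ = subst (λ i → ∣ i ∣ ≤ 3) (sym (value′-old u∈)) (D.bounded u∈)

      value′-v≢ : ∀ {u} → u ∈ S - v → u ~ v → value′ v ≢ value′ u
      value′-v≢ u∈ u~v eq = z≢ u∈ u~v (trans (sym value′≡z) (trans eq (value′-old u∈)))

      proper : ∀ {x y} → x ∈ S → y ∈ S → x ~ y → value′ x ≢ value′ y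
      proper x∈S y∈S x~y eq with ∈-split x∈S | ∈-split y∈S
      ... | inj₁ refl | inj₁ refl = irrefl refl x~y
      ... | inj₁ refl | inj₂ y∈ = value′-v≢ y∈ (~-sym x~y) eq
      ... | inj₂ x∈ | inj₁ refl = value′-v≢ x∈ x~y (sym eq)
      ... | inj₂ x∈ | inj₂ y∈ = D.proper x∈ y∈ x~y
        (trans (sym (value′-old x∈)) (trans eq (value′-old y∈)))

      1⇒in : ∀ {u w} → u ∈ S → w ∉ S → u ~ w → value′ u ≡ 1ℤ → w ⟶′ u
      1⇒in {w = w} u∈S w∉S u~w eq with ∈-split u∈S
      ... | inj₂ u∈ = old (D.1⇒in u∈ (w∉S ∘ ∈-weaken) u~w (trans (sym (value′-old u∈)) eq))
      -- At value 1 no new arc leaves `v`, so `q` must have directed the edge at `w` towards `v`.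
      ... | inj₁ refl = into ((u~w , w∉S) , decidable-stable (T? (q w)) λ ¬t →
        count≡0⇒empty from? (trans (proj₂ (proj₂ chosen)) (β.1⇒source (trans (sym value′≡z) eq)))
          w ((u~w , w∉S) , ¬t))

      -1⇒out : ∀ {u w} → u ∈ S → w ∉ S → u ~ w → value′ u ≡ -1ℤ → u ⟶′ w
      -1⇒out {w = w} u∈S w∉S u~w eq with ∈-split u∈S
      ... | inj₂ u∈ = old (D.-1⇒out u∈ (w∉S ∘ ∈-weaken) u~w (trans (sym (value′-old u∈)) eq))
      ... | inj₁ refl = from ((u~w , w∉S) , λ t →
        count≡0⇒empty into? (trans (proj₁ (proj₂ chosen)) (β.-1⇒sink (trans (sym value′≡z) eq)))
          w ((u~w , w∉S) , t))

    -- Every old arc at `v` comes from an edge to `S - v`. There is at most one such edge, so the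
    -- counts at `v` start from (0, 0), (1, 0) or (0, 1).
    extendAtLeaf : AtMostOneNeighbour S v → PartialOrientation S
    extendAtLeaf unique with any? (λ p → p ∈? (S - v) ×-dec p ~? v)
    ... | no none =
      let z , β = balanceRoot (count free?)
      in  extend (z , (λ u∈ u~v → contradiction (_ , u∈ , u~v) none) ,
            subst₂ (λ a b → Balance a b (count free?) z) (sym ins≡) (sym outs≡) β)
      where
      isolated : ∀ {x} → ¬ (v ⟶ x ⊎ x ⟶ v)
      isolated (inj₁ a) with D.arc⇒meets a
      ... | inj₁ v∈ = v∉ v∈
      ... | inj₂ x∈ = none (_ , x∈ , ~-sym (D.arc⇒adj a))
      isolated (inj₂ a) with D.arc⇒meets a
      ... | inj₁ x∈ = none (_ , x∈ , D.arc⇒adj a)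
      ... | inj₂ v∈ = v∉ v∈
      ins≡ : D.ins v ≡ 0
      ins≡ = count-empty (_⟶? v) λ _ a → isolated (inj₂ a)
      outs≡ : D.outs v ≡ 0
      outs≡ = count-empty (v ⟶?_) λ _ a → isolated (inj₁ a)
    ... | yes (p , p∈ , p~v) = extend (choice (D.adj⇒arc p∈ p~v))
      where
      onlyP : ∀ {u} → u ∈ S - v → u ~ v → u ≡ p
      onlyP u∈ u~v = unique (∈-weaken u∈) (∈-weaken p∈) u~v p~v

      tail≡p : ∀ {x} → x ⟶ v → x ≡ p
      tail≡p a with D.arc⇒meets a
      ... | inj₁ x∈ = onlyP x∈ (D.arc⇒adj a)
      ... | inj₂ v∈ = contradiction v∈ v∉

      head≡p : ∀ {x} → v ⟶ x → x ≡ p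
      head≡p a with D.arc⇒meets a
      ... | inj₁ v∈ = contradiction v∈ v∉
      ... | inj₂ x∈ = onlyP x∈ (~-sym (D.arc⇒adj a))

      avoidsP : ∀ {z} → z ≢ D.value p → ∀ {u} → u ∈ S - v → u ~ v → z ≢ D.value u
      avoidsP z≢ u∈ u~v rewrite onlyP u∈ u~v = z≢

      choice : p ⟶ v ⊎ v ⟶ p →
               ∃[ z ] (∀ {u} → u ∈ S - v → u ~ v → z ≢ D.value u) ×
                      Balance (D.ins v) (D.outs v) (count free?) z
      choice (inj₁ p⟶v) =
        -- Since `v` lies outside `S - v`, value 1 at `p` would force `v ⟶ p`, contradicting `p⟶v`;
        -- this is the guard.
        let z , z≢ , β = balanceIn (count free?) (D.value p) λ _ eq → D.asym p⟶v (D.1⇒in p∈ v∉ p~v eq)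
        in  z , avoidsP z≢ , subst₂ (λ a b → Balance a b (count free?) z) (sym ins≡) (sym outs≡) β
        where
        ins≡ : D.ins v ≡ 1
        ins≡ = trans (count-cong (_⟶? v) (_≟ p) (tail≡p , λ { refl → p⟶v })) (count-singleton p)
        outs≡ : D.outs v ≡ 0
        outs≡ = count-empty (v ⟶?_) λ _ a → D.asym p⟶v (subst (v ⟶_) (head≡p a) a)
      choice (inj₂ v⟶p) =
        let z , z≢ , β = balanceOut (count free?) (D.value p) λ _ eq → D.asym v⟶p (D.-1⇒out p∈ v∉ p~v eq)
        in  z , avoidsP z≢ , subst₂ (λ a b → Balance a b (count free?) z) (sym ins≡) (sym outs≡) β
        where
        ins≡ : D.ins v ≡ 0
        ins≡ = count-empty (_⟶? v) λ _ a → D.asym v⟶p (subst (_⟶ v) (tail≡p a) a)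
        outs≡ : D.outs v ≡ 1
        outs≡ = trans (count-cong (v ⟶?_) (_≟ p) (head≡p , λ { refl → v⟶p })) (count-singleton p)

  -- The vertex found by `leaf` is removed first and oriented last, so the removal order reversed is
  -- the processing order.
  partialOrientation : Acyclic G → ∀ {S} → Acc _⊂_ S → PartialOrientation S
  partialOrientation acyclic {S} (acc rec) with nonempty? S
  ... | no empty = record
    { _⟶_ = λ _ _ → ⊥ ; _⟶?_ = λ _ _ → no λ () ; arc⇒adj = λ () ; arc⇒meets = λ ()
    ; adj⇒arc = λ u∈S → contradiction (_ , u∈S) empty ; asym = λ ()
    ; bounded = λ u∈S → contradiction (_ , u∈S) empty
    ; proper = λ u∈S → contradiction (_ , u∈S) empty
    ; 1⇒in = λ u∈S → contradiction (_ , u∈S) empty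
    ; -1⇒out = λ u∈S → contradiction (_ , u∈S) empty }
  ... | yes nonempty =
    let v , v∈S , unique = leaf acyclic nonempty
    in  extendAtLeaf v∈S (partialOrientation acyclic (rec (x∈p⇒p-x⊂p v∈S))) unique

-- Existence of the minimum by finite search.

module _ {G : Graph} where
  open Graph G using (order; _~_)
  open Orientation

  ∣inOutDegree∣≤max : ∀ (D : Orientation G) v → ∣ inOutDegree D v ∣ ≤ maxInOutDegree D
  ∣inOutDegree∣≤max D v =
    All.lookup (xs≤max 0 _) (∈-map⁺ (λ v → ∣ inOutDegree D v ∣) (∈-allFin v))

  module _ (D E : Orientation G)
           (D⇒E : ∀ {u v} → _⟶_ D u v → _⟶_ E u v) (E⇒D : ∀ {u v} → _⟶_ E u v → _⟶_ D u v) where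

    -- Orientations carry arbitrary relations, so having the same arcs does not make two of them
    -- equal as records; degrees are transported along the two implications instead.
    inOutDegree-cong : ∀ v → inOutDegree D v ≡ inOutDegree E v
    inOutDegree-cong v = cong₂ (λ a b → + a ℤ- + b)
      (count-cong (λ u → _⟶?_ D u v) (λ u → _⟶?_ E u v) (D⇒E , E⇒D))
      (count-cong (_⟶?_ D v) (_⟶?_ E v) (D⇒E , E⇒D))

    maxInOutDegree-cong : maxInOutDegree D ≡ maxInOutDegree E
    maxInOutDegree-cong = cong (max 0) (map-cong (λ v → cong ∣_∣ (inOutDegree-cong v)) (allFin order))

    InOutProper-resp : InOutProper D → InOutProper E
    InOutProper-resp proper {u} {v} u~v eq =
      proper u~v (trans (inOutDegree-cong u) (trans eq (sym (inOutDegree-cong v))))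

module _ (G : Graph) where
  open Graph G renaming (sym to ~-sym)
  open Orientation using (InOutProper; maxInOutDegree)

  -- Sets of ordered pairs, flattened by `combine`, serve as codes because `anySubset?` can search
  -- them exhaustively.
  arcs : Subset (order * order) → Rel Vertex 0ℓ
  arcs s u v = combine u v ∈ s

  IsOrientation : Rel Vertex 0ℓ → Set
  IsOrientation _⟶_ = ∀ u v → (u ⟶ v → u ~ v) × (u ~ v → u ⟶ v ⊎ v ⟶ u) × (u ⟶ v → ¬ v ⟶ u)

  isOrientation? : ∀ s → Dec (IsOrientation (arcs s))
  isOrientation? s = all? λ u → all? λ v →
    (combine u v ∈? s →-dec u ~? v) ×-dec
    (u ~? v →-dec (combine u v ∈? s ⊎-dec combine v u ∈? s)) ×-dec
    (combine u v ∈? s →-dec ¬? (combine v u ∈? s))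

  decode : ∀ s → IsOrientation (arcs s) → Orientation G
  decode s o = record
    { _⟶_     = arcs s
    ; _⟶?_    = λ u v → combine u v ∈? s
    ; arc⇒adj = proj₁ (o _ _)
    ; adj⇒arc = proj₁ (proj₂ (o _ _))
    ; asym    = proj₂ (proj₂ (o _ _))
    }

  module _ (D : Orientation G) where
    open Orientation D using (_⟶_; _⟶?_; arc⇒adj; adj⇒arc; asym)

    encode : Subset (order * order)
    encode = Vec.tabulate λ i → does (uncurry _⟶?_ (remQuot order i))

    lookup-encode : ∀ u v → Vec.lookup encode (combine u v) ≡ does (u ⟶? v)
    lookup-encode u v = trans (lookup∘tabulate _ (combine u v))
      (cong (does ∘ uncurry _⟶?_) (remQuot-combine u v))

    encode⁺ : ∀ {u v} → u ⟶ v → arcs encode u v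
    encode⁺ {u} {v} a = lookup⇒[]= (combine u v) encode
      (trans (lookup-encode u v) (dec-true (u ⟶? v) a))

    encode⁻ : ∀ {u v} → arcs encode u v → u ⟶ v
    encode⁻ {u} {v} a = decidable-stable (u ⟶? v) λ ¬a →
      case (trans (sym ([]=⇒lookup a)) (trans (lookup-encode u v) (dec-false (u ⟶? v) ¬a)))
      where
      case : true ≢ false
      case ()

    encode-isOrientation : IsOrientation (arcs encode)
    encode-isOrientation u v =
      (arc⇒adj ∘ encode⁻) , (Sum.map encode⁺ encode⁺ ∘ adj⇒arc) , λ a b → asym (encode⁻ a) (encode⁻ b)

  ProperBelow : ℕ → Orientation G → Set
  ProperBelow k D = InOutProper D × maxInOutDegree D < k

  properBelow? : ∀ k D → Dec (ProperBelow k D)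
  properBelow? k D = map′ (λ p {u} {v} → p u v) (λ p u v → p)
    (all? λ u → all? λ v → u ~? v →-dec ¬? (inOutDegree u ℤ.≟ inOutDegree v))
    ×-dec maxInOutDegree D ℕ.<? k
    where open Orientation D using (inOutDegree)

  -- Each orientation has the same arcs as the decoding of its code, so searching the codes
  -- suffices.
  ∃properBelow? : ∀ k → Dec (Σ[ D ∈ Orientation G ] ProperBelow k D)
  ∃properBelow? k = map′
    (λ (s , o , below) → decode s o , below)
    (λ (D , proper , D<k) →
       let o = encode-isOrientation D
           E = decode (encode D) o
       in  encode D , o ,
           (λ {_} {_} → InOutProper-resp D E (encode⁺ D) (encode⁻ D) proper) ,
           subst (_< k) (maxInOutDegree-cong D E (encode⁺ D) (encode⁻ D)) D<k)
    (anySubset? coded?)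
    where
    coded? : ∀ s → Dec (Σ[ o ∈ IsOrientation (arcs s) ] ProperBelow k (decode s o))
    coded? s with isOrientation? s
    ... | no ¬o = no (¬o ∘ proj₁)
    ... | yes o with properBelow? k (decode s o)
    ...   | yes below = yes (o , below)
    ...   | no ¬below = no (¬below ∘ proj₂)

  -- The search either yields a proper orientation with smaller maximum, from which the descent
  -- continues, or certifies that the current one is minimal.
  orientationNumber : (D : Orientation G) → InOutProper D →
                      ∃[ k ] IsInOutProperOrientationNumber G k × k ≤ maxInOutDegree D
  orientationNumber D proper = descend D proper (<-wellFounded _)
    where
    descend : ∀ D → InOutProper D → Acc _<_ (maxInOutDegree D) →
              ∃[ k ] IsInOutProperOrientationNumber G k × k ≤ maxInOutDegree D
    descend D proper (acc rec) with ∃properBelow? (maxInOutDegree D)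
    ... | yes (E , properE , E<D) =
      let k , isNumber , k≤E = descend E properE (rec E<D)
      in  k , isNumber , ℕ.≤-trans k≤E (ℕ.<⇒≤ E<D)
    ... | no none = maxInOutDegree D , record
      { attained = D , proper , refl
      ; minimal  = λ E properE → ℕ.≮⇒≥ λ E<D → none (E , properE , E<D) } , ℕ.≤-refl

-- The upper bound, from a partial orientation on all vertices.

acyclic⇒number≤3 : ∀ G → Acyclic G → ∃[ k ] IsInOutProperOrientationNumber G k × k ≤ 3
acyclic⇒number≤3 G acyclic =
  let k , isNumber , k≤ = orientationNumber G D (proper ∈⊤ ∈⊤)
  in  k , isNumber , ℕ.≤-trans k≤ (max≤v⁺ z≤n (All.map⁺ (All.universal (λ v → bounded {v} ∈⊤) (allFin (Graph.order G)))))
  where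
  open PartialOrientation (partialOrientation G acyclic (⊂-wellFounded ⊤))
  D : Orientation G
  D = record { _⟶_ = _⟶_ ; _⟶?_ = _⟶?_ ; arc⇒adj = arc⇒adj ; adj⇒arc = adj⇒arc ∈⊤ ; asym = asym }

-- Sharpness: the star with three leaves.

StarAdj : Rel (Fin 4) 0ℓ
StarAdj zero    (suc _) = Unit
StarAdj (suc _) zero    = Unit
StarAdj _       _       = ⊥

star : Graph
star = record
  { order  = 4
  ; _~_    = StarAdj
  ; _~?_   = λ { zero zero → no λ () ; zero (suc _) → yes tt ; (suc _) zero → yes tt ; (suc _) (suc _) → no λ () }
  ; sym    = λ { {zero} {suc _} _ → tt ; {suc _} {zero} _ → tt }
  ; irrefl = λ { {zero} refl () ; {suc _} refl () }
  }

star-connected : Connected star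
star-connected zero    zero    = ε
star-connected zero    (suc _) = tt ◅ ε
star-connected (suc _) zero    = tt ◅ ε
star-connected (suc _) (suc _) = _◅_ {j = zero} tt (tt ◅ ε)

-- Every edge joins the centre to a leaf, so a cycle would have to repeat the centre or put two
-- leaves next to each other.
star-acyclic : Acyclic star
star-acyclic zero (suc _) zero _ ((_ ∷ u≢w ∷ _) ∷ _ , _) = u≢w refl
star-acyclic zero (suc _) (suc _) _ (_ , _ ∷ () ∷ _)
star-acyclic zero zero _ _ (_ , () ∷ _)
star-acyclic (suc _) (suc _) _ _ (_ , () ∷ _)
star-acyclic (suc _) zero zero _ (_ , _ ∷ () ∷ _)
star-acyclic (suc _) zero (suc _) [] (_ , _ ∷ _ ∷ () ∷ _)
star-acyclic (suc _) zero (suc _) (zero ∷ _) (_ ∷ (_ ∷ v≢x ∷ _) ∷ _ , _) = v≢x refl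
star-acyclic (suc _) zero (suc _) (suc _ ∷ _) (_ , _ ∷ _ ∷ () ∷ _)

star-isTree : IsTree star
star-isTree = record { nonEmpty = _ ; connected = star-connected ; acyclic = star-acyclic }

-- The Booleans tell which edges point to the centre. Up to having the same arcs, these eight are
-- all orientations of the star, and their degrees compute.
starOrientation : Bool → Bool → Bool → Orientation star
starOrientation a b c = record
  { _⟶_ = λ u v → T (arc u v) ; _⟶?_ = λ u v → T? (arc u v)
  ; arc⇒adj = λ { {zero} {suc _} _ → tt ; {suc _} {zero} _ → tt }
  ; adj⇒arc = λ { {zero} {suc i} _ → one (inward i) ; {suc i} {zero} _ → Sum.swap (one (inward i)) }
  ; asym = λ { {zero} {suc i} → clash (inward i) ; {suc i} {zero} s t → clash (inward i) t s }
  }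
  where
  inward : Fin 3 → Bool
  inward zero = a
  inward (suc zero) = b
  inward (suc (suc zero)) = c
  arc : Fin 4 → Fin 4 → Bool
  arc zero    (suc i) = not (inward i)
  arc (suc i) zero    = inward i
  arc _       _       = false
  one : ∀ x → T (not x) ⊎ T x
  one true = inj₂ tt
  one false = inj₁ tt
  clash : ∀ x → T (not x) → ¬ T x
  clash true ()
  clash false _ ()

-- In the mixed cases `proper` is applied to the edge directed unlike the other two: its leaf shares
-- the value 1 or -1 of the centre.
starOrientation-minimal : ∀ a b c → Orientation.InOutProper (starOrientation a b c) →
                          3 ≤ ∣ Orientation.inOutDegree (starOrientation a b c) zero ∣
starOrientation-minimal true  true  true  _ = ℕ.≤-refl
starOrientation-minimal false false false _ = ℕ.≤-refl
starOrientation-minimal false true  true  proper = contradiction refl (proper {zero} {suc zero} tt)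
starOrientation-minimal false true  false proper = contradiction refl (proper {zero} {suc (suc zero)} tt)
starOrientation-minimal false false true  proper = contradiction refl (proper {zero} {suc (suc (suc zero))} tt)
starOrientation-minimal true  false false proper = contradiction refl (proper {zero} {suc zero} tt)
starOrientation-minimal true  false true  proper = contradiction refl (proper {zero} {suc (suc zero)} tt)
starOrientation-minimal true  true  false proper = contradiction refl (proper {zero} {suc (suc (suc zero))} tt)

star≥3 : ∀ D → Orientation.InOutProper D → 3 ≤ Orientation.maxInOutDegree {star} D
star≥3 D proper = begin
  3                                  ≤⟨ starOrientation-minimal a b c (InOutProper-resp D E D⇒E E⇒D proper) ⟩
  ∣ Orientation.inOutDegree E zero ∣  ≡⟨ cong ∣_∣ (inOutDegree-cong D E D⇒E E⇒D zero) ⟨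
  ∣ inOutDegree zero ∣                ≤⟨ ∣inOutDegree∣≤max D zero ⟩
  maxInOutDegree                     ∎
  where
  open Orientation D
  open ℕ.≤-Reasoning
  a = ⌊ suc zero ⟶? zero ⌋
  b = ⌊ suc (suc zero) ⟶? zero ⌋
  c = ⌊ suc (suc (suc zero)) ⟶? zero ⌋
  E = starOrientation a b c
  open Orientation E using () renaming (_⟶_ to _⟶ᴱ_)

  toward : ∀ i → (suc i ⟶ zero → suc i ⟶ᴱ zero) × (suc i ⟶ᴱ zero → suc i ⟶ zero)
  toward zero = fromWitness , toWitness
  toward (suc zero) = fromWitness , toWitness
  toward (suc (suc zero)) = fromWitness , toWitness

  -- In both orientations an outward arc is present exactly when the inward one is absent, so the
  -- agreement carries over from `toward`.
  away : ∀ i → (zero ⟶ suc i → zero ⟶ᴱ suc i) × (zero ⟶ᴱ suc i → zero ⟶ suc i)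
  away i =
    (λ d → [ id , (λ e → contradiction d (asym (proj₂ (toward i) e))) ]′ (Orientation.adj⇒arc E {zero} {suc i} tt)) ,
    (λ e → [ id , (λ d → contradiction (proj₁ (toward i) d) (Orientation.asym E {zero} {suc i} e)) ]′ (adj⇒arc {zero} {suc i} tt))

  D⇒E : ∀ {u v} → u ⟶ v → u ⟶ᴱ v
  D⇒E {zero}  {zero}  d = contradiction (arc⇒adj d) λ ()
  D⇒E {zero}  {suc i} d = proj₁ (away i) d
  D⇒E {suc i} {zero}  d = proj₁ (toward i) d
  D⇒E {suc _} {suc _} d = contradiction (arc⇒adj d) λ ()

  E⇒D : ∀ {u v} → u ⟶ᴱ v → u ⟶ v
  E⇒D {zero}  {suc i} e = proj₂ (away i) e
  E⇒D {suc i} {zero}  e = proj₂ (toward i) e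

-- The number `k` is attained, so a lower bound for all proper orientations applies to it. For the
-- star, the bound for forests supplies `k ≤ 3` without an explicit orientation.
number≡ : ∀ {G m} → ∃[ k ] IsInOutProperOrientationNumber G k × k ≤ m →
          (∀ D → Orientation.InOutProper D → m ≤ Orientation.maxInOutDegree {G} D) →
          IsInOutProperOrientationNumber G m
number≡ {G} (k , isNumber@record { attained = D , proper , refl } , k≤m) m≤ =
  subst (IsInOutProperOrientationNumber G) (ℕ.≤-antisym k≤m (m≤ D proper)) isNumber

theorem2 : (∀ (T : Graph) → IsTree T →
    ∃[ k ] IsInOutProperOrientationNumber T k × k ≤ 3)
    ×
    (Σ[ T ∈ Graph ] IsTree T × IsInOutProperOrientationNumber T 3)
theorem2 = (λ T isTree → acyclic⇒number≤3 T (IsTree.acyclic isTree)) ,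
  star , star-isTree , number≡ (acyclic⇒number≤3 star star-acyclic) star≥3
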